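{- The problems VCPNEW, VCOP and VCUP are pairwise equivalent: every instance of one can be formulated as an instance of another on the same graph so that an optimal solution of the new instance is an optimal solution of the original instance.
   Context: Let $G=(V,E)$ be a graph, with vertex weights $c_i\in\mathbb{R}$ and edge weights $q^1_{ij},q^2_{ij}\in\mathbb{R}$. A vertex cover is a set $P\subseteq V$ containing at least one endpoint of every edge. For $P\subseteq V$ let $E_1(P)$ be the edges with exactly one endpoint in $P$ and $E_2(P)$ the edges with both endpoints in $P$. The vertex cover problem with node and edge weights (VCPNEW) is to find a vertex cover $P$ minimizing $\sum_{i\in P}c_i+\sum_{(i,j)\in E_1(P)}q^1_{ij}+\sum_{(i,j)\in E_2(P)}q^2_{ij}$. VCOP (vertex cover problem with over cover penalties) is the special case $q^1_{ij}=0$ for all edges; VCUP (vertex cover problem with under cover penalties) is the special case $q^2_{ij}=0$ for all edges. -}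

module Defs where

open import Data.Bool using (true; false; _∧_; _xor_)
open import Data.Fin using (Fin; zero; suc)
import Data.Fin as Fin
open import Data.Fin.Subset using (Subset; _∈_)
open import Data.Nat using (ℕ; _⊔_) renaming (_≤_ to _≤ℕ_)
import Data.Nat.Properties as ℕ
open import Data.Product using (_×_; _,_; ∃-syntax)
open import Data.Rational using (ℚ; 0ℚ; ½; ∣_∣)
  renaming (_+_ to _+ℚ_; _-_ to _-ℚ_; -_ to -ℚ_; _*_ to _*ℚ_; _≤_ to _≤ℚ_; _<_ to _<ℚ_)
import Data.Rational.Properties as ℚ
open import Data.Sum using (_⊎_)
open import Data.Unit using (⊤)
open import Data.Vec using ([]; _∷_; lookup; tabulate)
open import Function.Definitions using (Injective)
open import Relation.Binary.PropositionalEquality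
  using (_≡_; sym; trans; cong; subst; subst₂)
open import Algebra.Bundles using (CommutativeMonoid)
open import Algebra.Properties.CommutativeSemigroup
  (CommutativeMonoid.commutativeSemigroup ℚ.+-0-commutativeMonoid) using (interchange)

infix  4 _≃_ _≤_
infixl 6 _+_

record ℝ : Set where
  constructor mkℝ
  field
    seq    : ℕ → ℚ
    cauchy : ∀ ε → 0ℚ <ℚ ε →
             ∃[ N ] (∀ m n → N ≤ℕ m → N ≤ℕ n → ∣ seq m -ℚ seq n ∣ <ℚ ε)

open ℝ public

_≃_ : ℝ → ℝ → Set
x ≃ y = ∀ ε → 0ℚ <ℚ ε →
        ∃[ N ] (∀ n → N ≤ℕ n → ∣ seq x n -ℚ seq y n ∣ <ℚ ε)

_≤_ : ℝ → ℝ → Set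
x ≤ y = ∀ ε → 0ℚ <ℚ ε →
        ∃[ N ] (∀ n → N ≤ℕ n → seq x n ≤ℚ seq y n +ℚ ε)

0ℝ : ℝ
0ℝ = mkℝ (λ _ → 0ℚ) λ ε 0<ε → 0 , λ _ _ _ _ → 0<ε

private
  ½-pos : ∀ {ε} → 0ℚ <ℚ ε → 0ℚ <ℚ ½ *ℚ ε
  ½-pos {ε} 0<ε = subst (_<ℚ ½ *ℚ ε) (ℚ.*-zeroʳ ½) (ℚ.*-monoʳ-<-pos ½ 0<ε)

  ½+½ : ∀ ε → ½ *ℚ ε +ℚ ½ *ℚ ε ≡ ε
  ½+½ ε = trans (sym (ℚ.*-distribʳ-+ ε ½ ½)) (ℚ.*-identityˡ ε)

  +-‿interchange : ∀ a b c d → (a +ℚ b) -ℚ (c +ℚ d) ≡ (a -ℚ c) +ℚ (b -ℚ d)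
  +-‿interchange a b c d =
    trans (cong (a +ℚ b +ℚ_) (ℚ.neg-distrib-+ c d)) (interchange a b (-ℚ c) (-ℚ d))

_+_ : ℝ → ℝ → ℝ
seq    (x + y) n     = seq x n +ℚ seq y n
cauchy (x + y) ε 0<ε
  with M , hx ← cauchy x (½ *ℚ ε) (½-pos 0<ε)
     | N , hy ← cauchy y (½ *ℚ ε) (½-pos 0<ε)
  = M ⊔ N , λ m n p q →
    subst₂ _<ℚ_ (cong ∣_∣ (sym (+-‿interchange (seq x m) (seq y m) (seq x n) (seq y n)))) (½+½ ε)
      (ℚ.≤-<-trans (ℚ.∣p+q∣≤∣p∣+∣q∣ (seq x m -ℚ seq x n) (seq y m -ℚ seq y n))
        (ℚ.+-mono-<
          (hx m n (ℕ.≤-trans (ℕ.m≤m⊔n M N) p) (ℕ.≤-trans (ℕ.m≤m⊔n M N) q))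
          (hy m n (ℕ.≤-trans (ℕ.m≤n⊔m M N) p) (ℕ.≤-trans (ℕ.m≤n⊔m M N) q))))

∑[_] : ∀ {n} → Subset n → (Fin n → ℝ) → ℝ
∑[ []        ] f = 0ℝ
∑[ true  ∷ S ] f = f zero + ∑[ S ] (λ i → f (suc i))
∑[ false ∷ S ] f = ∑[ S ] (λ i → f (suc i))

-- A finite simple graph. `ordered` stores each undirected edge with its
-- smaller endpoint first, which also excludes loops; together with
-- `simple` each 2-element set of vertices is an edge at most once.

record Graph : Set where
  field
    order   : ℕ
    size    : ℕ
    left    : Fin size → Fin order
    right   : Fin size → Fin order
    ordered : ∀ e → left e Fin.< right e
    simple  : Injective _≡_ _≡_ (λ e → left e , right e)

  Vertex Edge : Set
  Vertex = Fin order
  Edge   = Fin size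

module _ (G : Graph) where
  open Graph G

  IsVertexCover : Subset order → Set
  IsVertexCover P = ∀ e → left e ∈ P ⊎ right e ∈ P

  E₁ E₂ : Subset order → Subset size
  E₁ P = tabulate λ e → lookup P (left e) xor lookup P (right e)
  E₂ P = tabulate λ e → lookup P (left e) ∧ lookup P (right e)

record Instance (G : Graph) : Set where
  open Graph G
  field
    c  : Vertex → ℝ
    q¹ : Edge → ℝ
    q² : Edge → ℝ

module _ {G : Graph} (I : Instance G) where
  open Graph G
  open Instance I

  cost : Subset order → ℝ
  cost P = ∑[ P ] c + ∑[ E₁ G P ] q¹ + ∑[ E₂ G P ] q²

  IsOptimal : Subset order → Set
  IsOptimal P = IsVertexCover G P × (∀ Q → IsVertexCover G Q → cost P ≤ cost Q)

-- All three problems minimise the same objective `cost`; they differ only in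
-- which instances they admit.

Problem : Set₁
Problem = ∀ {G} → Instance G → Set

VCPNEW VCOP VCUP : Problem
VCPNEW _ = ⊤
VCOP   I = ∀ e → Instance.q¹ I e ≃ 0ℝ
VCUP   I = ∀ e → Instance.q² I e ≃ 0ℝ

Formulable : Problem → Problem → Set
Formulable A B = ∀ {G} (I : Instance G) → A I →
  ∃[ J ] (B {G} J × (∀ P → IsOptimal J P → IsOptimal I P))

Equivalent : Problem → Problem → Set
Equivalent A B = Formulable A B × Formulable B A

{-# OPTIONS --safe #-}
-- An edge met by a vertex cover P lies in exactly one of E₁(P) and E₂(P), so
-- Σ_{E₁} q¹ + Σ_{E₂} q² = Σ_{E₁} (q¹ − q²) + Σ_E q² = Σ_{E₂} (q² − q¹) + Σ_E q¹.
-- Dropping the sum over all of E, which does not depend on P, leaves a VCUP,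
-- respectively VCOP, objective with the same minimisers.

module Submission where

open import Defs
open import Algebra.Lattice.Properties.BooleanAlgebra using (¬-involutive)
open import Data.Bool using (true; false; not; _∧_; _xor_)
open import Data.Bool.Properties using (not-involutive)
open import Data.Fin using (Fin; zero; suc)
open import Data.Fin.Subset using (Subset; ∁; ⊤)
open import Data.Fin.Subset.Properties using (∪-∩-booleanAlgebra)
open import Data.Nat using (ℕ)
open import Data.Product using (_×_; _,_)
open import Data.Rational using (ℚ; 0ℚ; ∣_∣)
  renaming (_+_ to _+ℚ_; _-_ to _-ℚ_; -_ to -ℚ_; _≤_ to _≤ℚ_; _<_ to _<ℚ_)
import Data.Rational.Properties as ℚ
open import Data.Rational.Solver using (module +-*-Solver)
open import Data.Sum using (inj₁; inj₂)
open import Data.Unit using (tt)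
open import Data.Vec using ([]; _∷_; lookup)
open import Data.Vec.Properties using ([]=⇒lookup; tabulate-cong; tabulate-∘)
open import Relation.Binary.PropositionalEquality
  using (_≡_; refl; sym; trans; cong; subst; subst₂; module ≡-Reasoning)
open +-*-Solver using (solve; _:=_; _:+_; _:-_)

infix  8 -_
infixl 6 _-_

-_ : ℝ → ℝ
seq    (- x) n = -ℚ seq x n
cauchy (- x) ε 0<ε with N , close ← cauchy x ε 0<ε =
  N , λ m n N≤m N≤n → subst (_<ℚ ε) (sym (∣-p--q∣ (seq x m) (seq x n))) (close m n N≤m N≤n)
  where
  ∣-p--q∣ : ∀ p q → ∣ -ℚ p -ℚ -ℚ q ∣ ≡ ∣ p -ℚ q ∣
  ∣-p--q∣ p q = trans (cong ∣_∣ (sym (ℚ.neg-distrib-+ p (-ℚ q)))) (ℚ.∣-p∣≡∣p∣ (p -ℚ q))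

_-_ : ℝ → ℝ → ℝ
x - y = x + - y

≃-refl : ∀ x → x ≃ x
≃-refl x ε 0<ε =
  0 , λ n _ → subst (λ d → ∣ d ∣ <ℚ ε) (sym (ℚ.+-inverseʳ (seq x n))) 0<ε

-- The shift is exact at every index, so the `N` that `x ≤ y` gives for `ε` serves again: add `k n`
-- to both sides of the rational inequality.
≤-resp-shift : ∀ {x y x′ y′} (k : ℕ → ℚ) →
               (∀ n → seq x′ n ≡ seq x n +ℚ k n) → (∀ n → seq y′ n ≡ seq y n +ℚ k n) →
               x ≤ y → x′ ≤ y′
≤-resp-shift {y = y} k x′≡ y′≡ x≤y ε 0<ε with N , le ← x≤y ε 0<ε =
  N , λ n N≤n → subst₂ _≤ℚ_ (sym (x′≡ n))
    (trans (solve 3 (λ a e k → a :+ e :+ k := a :+ k :+ e) refl (seq y n) ε (k n))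
           (cong (_+ℚ ε) (sym (y′≡ n))))
    (ℚ.+-monoˡ-≤ (k n) (le n N≤n))

∑-0 : ∀ {m} (S : Subset m) n → seq (∑[ S ] (λ _ → 0ℝ)) n ≡ 0ℚ
∑-0 []          n = refl
∑-0 (true  ∷ S) n = trans (ℚ.+-identityˡ _) (∑-0 S n)
∑-0 (false ∷ S) n = ∑-0 S n

-- On `S` write `f i` as `(f i - g i) + g i`; the `g i` from `S` and from `∁ S` then make up the
-- full sum. Working with `n`-th terms turns this into an identity in ℚ.
∑-∁ : ∀ {m} (S : Subset m) (f g : Fin m → ℝ) n →
      seq (∑[ S ] f + ∑[ ∁ S ] g) n ≡ seq (∑[ S ] (λ i → f i - g i) + ∑[ ⊤ ] g) n
∑-∁ []          f g n = refl
∑-∁ (true  ∷ S) f g n = begin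
  (f₀ +ℚ F) +ℚ G                ≡⟨ ℚ.+-assoc f₀ F G ⟩
  f₀ +ℚ (F +ℚ G)                ≡⟨ cong (f₀ +ℚ_) (∑-∁ S (λ i → f (suc i)) (λ i → g (suc i)) n) ⟩
  f₀ +ℚ (D +ℚ T)                ≡⟨ solve 4 (λ f g d t → f :+ (d :+ t) := (f :- g :+ d) :+ (g :+ t))
                                     refl f₀ g₀ D T ⟩
  (f₀ -ℚ g₀ +ℚ D) +ℚ (g₀ +ℚ T)  ∎
  where
  open ≡-Reasoning
  f₀ = seq (f zero) n
  g₀ = seq (g zero) n
  F = seq (∑[ S ] (λ i → f (suc i))) n
  G = seq (∑[ ∁ S ] (λ i → g (suc i))) n
  D = seq (∑[ S ] (λ i → f (suc i) - g (suc i))) n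
  T = seq (∑[ ⊤ ] (λ i → g (suc i))) n
∑-∁ (false ∷ S) f g n = begin
  -- The head is outside `S`, so `g₀` occurs in the second sum on both sides; it is moved to the
  -- front to expose the induction hypothesis.
  F +ℚ (g₀ +ℚ G)  ≡⟨ swap F g₀ G ⟩
  g₀ +ℚ (F +ℚ G)  ≡⟨ cong (g₀ +ℚ_) (∑-∁ S (λ i → f (suc i)) (λ i → g (suc i)) n) ⟩
  g₀ +ℚ (D +ℚ T)  ≡⟨ swap D g₀ T ⟨
  D +ℚ (g₀ +ℚ T)  ∎
  where
  open ≡-Reasoning
  g₀ = seq (g zero) n
  F = seq (∑[ S ] (λ i → f (suc i))) n
  G = seq (∑[ ∁ S ] (λ i → g (suc i))) n
  D = seq (∑[ S ] (λ i → f (suc i) - g (suc i))) n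
  T = seq (∑[ ⊤ ] (λ i → g (suc i))) n
  swap : ∀ a b c → a +ℚ (b +ℚ c) ≡ b +ℚ (a +ℚ c)
  swap = solve 3 (λ a b c → a :+ (b :+ c) := b :+ (a :+ c)) refl

module _ (G : Graph) {P : Subset (Graph.order G)} (cover : IsVertexCover G P) where
  open Graph G

  -- Covering rules out edges with no endpoint in `P`, the only ones that would lie in neither set.
  E₂≡∁E₁ : E₂ G P ≡ ∁ (E₁ G P)
  E₂≡∁E₁ = trans (tabulate-cong split) (tabulate-∘ not _)
    where
    split : ∀ e → lookup P (left e) ∧ lookup P (right e)
                ≡ not (lookup P (left e) xor lookup P (right e))
    split e with cover e
    ... | inj₁ l∈P rewrite []=⇒lookup l∈P = sym (not-involutive _)
    -- `_∧_` and `_xor_` compute on their first argument, so knowing the right bit is not enough to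
    -- reduce them.
    ... | inj₂ r∈P rewrite []=⇒lookup r∈P with lookup P (left e)
    ...   | true  = refl
    ...   | false = refl

  E₁≡∁E₂ : E₁ G P ≡ ∁ (E₂ G P)
  E₁≡∁E₂ = trans (sym (¬-involutive (∪-∩-booleanAlgebra size) (E₁ G P))) (cong ∁ (sym E₂≡∁E₁))

module _ {G : Graph} (I : Instance G) where
  open Graph G
  open Instance I

  -- Both instances have the same covers, and `k` is the same for all of them, so it leaves every
  -- comparison between covers unchanged.
  optimal-shift : (J : Instance G) (k : ℕ → ℚ) →
                  (∀ Q → IsVertexCover G Q → ∀ n → seq (cost I Q) n ≡ seq (cost J Q) n +ℚ k n) →
                  ∀ P → IsOptimal J P → IsOptimal I P
  optimal-shift J k shift P (cover , optimal) =
    cover , λ Q coverQ →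
      ≤-resp-shift {cost J P} {cost J Q} {cost I P} {cost I Q} k
        (shift P cover) (shift Q coverQ) (optimal Q coverQ)

  toVCOP toVCUP : Instance G
  toVCOP = record { c = c ; q¹ = λ _ → 0ℝ ; q² = λ e → q² e - q¹ e }
  toVCUP = record { c = c ; q¹ = λ e → q¹ e - q² e ; q² = λ _ → 0ℝ }

  cost-toVCOP : ∀ Q → IsVertexCover G Q → ∀ n →
                seq (cost I Q) n ≡ seq (cost toVCOP Q) n +ℚ seq (∑[ ⊤ ] q¹) n
  cost-toVCOP Q cover n = begin
    C +ℚ seq (∑[ E₁ G Q ] q¹) n +ℚ B
      -- This prepares `∑-∁` with `S` = `E₂ G Q`, which splits off the total `T` of `q¹`,
      -- independent of `Q`.
      ≡⟨ cong (λ S → C +ℚ seq (∑[ S ] q¹) n +ℚ B) (E₁≡∁E₂ G cover) ⟩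
    C +ℚ A +ℚ B
      ≡⟨ solve 3 (λ c a b → c :+ a :+ b := c :+ (b :+ a)) refl C A B ⟩
    C +ℚ (B +ℚ A)
      ≡⟨ cong (C +ℚ_) (∑-∁ (E₂ G Q) q² q¹ n) ⟩
    C +ℚ (D +ℚ T)
      ≡⟨ ℚ.+-assoc C D T ⟨
    C +ℚ D +ℚ T
      ≡⟨ cong (λ c → c +ℚ D +ℚ T) (ℚ.+-identityʳ C) ⟨
    C +ℚ 0ℚ +ℚ D +ℚ T
      -- The inserted zero is read as the `E₁` sum of the vanishing `q¹` weights of `toVCOP`.
      ≡⟨ cong (λ z → C +ℚ z +ℚ D +ℚ T) (∑-0 (E₁ G Q) n) ⟨
    seq (cost toVCOP Q) n +ℚ T ∎
    where
    open ≡-Reasoning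
    C = seq (∑[ Q ] c) n
    A = seq (∑[ ∁ (E₂ G Q) ] q¹) n
    B = seq (∑[ E₂ G Q ] q²) n
    D = seq (∑[ E₂ G Q ] (λ e → q² e - q¹ e)) n
    T = seq (∑[ ⊤ ] q¹) n

  cost-toVCUP : ∀ Q → IsVertexCover G Q → ∀ n →
                seq (cost I Q) n ≡ seq (cost toVCUP Q) n +ℚ seq (∑[ ⊤ ] q²) n
  cost-toVCUP Q cover n = begin
    C +ℚ A +ℚ seq (∑[ E₂ G Q ] q²) n
      -- Here `E₁ G Q` plays the part of `S`, and the total of `q²` splits off.
      ≡⟨ cong (λ S → C +ℚ A +ℚ seq (∑[ S ] q²) n) (E₂≡∁E₁ G cover) ⟩
    C +ℚ A +ℚ B
      ≡⟨ ℚ.+-assoc C A B ⟩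
    C +ℚ (A +ℚ B)
      ≡⟨ cong (C +ℚ_) (∑-∁ (E₁ G Q) q¹ q² n) ⟩
    C +ℚ (D +ℚ T)
      ≡⟨ ℚ.+-assoc C D T ⟨
    C +ℚ D +ℚ T
      ≡⟨ cong (_+ℚ T) (ℚ.+-identityʳ (C +ℚ D)) ⟨
    C +ℚ D +ℚ 0ℚ +ℚ T
      ≡⟨ cong (λ z → C +ℚ D +ℚ z +ℚ T) (∑-0 (E₂ G Q) n) ⟨
    seq (cost toVCUP Q) n +ℚ T ∎
    where
    open ≡-Reasoning
    C = seq (∑[ Q ] c) n
    A = seq (∑[ E₁ G Q ] q¹) n
    B = seq (∑[ ∁ (E₁ G Q) ] q²) n
    D = seq (∑[ E₁ G Q ] (λ e → q¹ e - q² e)) n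
    T = seq (∑[ ⊤ ] q²) n

formulable-VCPNEW : (A : Problem) → Formulable A VCPNEW
formulable-VCPNEW A I _ = I , tt , λ _ optimal → optimal

-- Keeping `A` general lets one construction serve both VCPNEW and VCUP as the source.
formulable-VCOP : (A : Problem) → Formulable A VCOP
formulable-VCOP A I _ =
  -- The inferred shift is the sequence of the sum of `q¹` over all edges.
  toVCOP I , (λ _ → ≃-refl 0ℝ) , optimal-shift I (toVCOP I) _ (cost-toVCOP I)

formulable-VCUP : (A : Problem) → Formulable A VCUP
formulable-VCUP A I _ =
  toVCUP I , (λ _ → ≃-refl 0ℝ) , optimal-shift I (toVCUP I) _ (cost-toVCUP I)

theorem6 : Equivalent VCPNEW VCOP × Equivalent VCPNEW VCUP × Equivalent VCOP VCUP
theorem6 =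
    (formulable-VCOP VCPNEW , formulable-VCPNEW VCOP)
  , (formulable-VCUP VCPNEW , formulable-VCPNEW VCUP)
  , (formulable-VCUP VCOP , formulable-VCOP VCUP)
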